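{- For every finite simple graph $G$ on $n$ vertices with minimum degree at least $2$, $\gamma_{tg}(G) \leq \frac{5}{7}n+\frac{5}{7}$.
   Context: Let $G$ be a graph without isolated vertices. A vertex is totally dominated by a set $A\subseteq V(G)$ if it has a neighbor in $A$; a totally dominating set is a set totally dominating every vertex of $G$. In the total domination game on $G$, two players, Dominator and Staller, alternately select vertices of $G$, Dominator moving first. Each selected vertex must strictly increase the number of vertices totally dominated by the set of selected vertices. The game ends when the set of selected vertices is a totally dominating set of $G$. Dominator aims to minimize the number of selected vertices at the end, Staller aims to maximize it. The game total domination number $\gamma_{tg}(G)$ is the number of selected vertices at the end of the game when Dominator starts and both players play optimally. -}

module Defs where

open import Data.Bool using (Bool; true; false; not; if_then_else_)
open import Data.Nat using (ℕ; zero; suc; _⊓_; _⊔_; _<ᵇ_)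
open import Data.Fin using (Fin)
open import Data.List using (List; []; _∷_; map; foldr; allFin; filterᵇ)
open import Data.Nat.ListAction using (sum)
open import Data.Bool.ListAction using (any; all)
open import Relation.Binary.PropositionalEquality using (_≡_)

record Graph (n : ℕ) : Set where
  field
    adj    : Fin n → Fin n → Bool
    sym    : ∀ u v → adj u v ≡ adj v u
    irrefl : ∀ v → adj v v ≡ false
open Graph public

deg : ∀ {n} → Graph n → Fin n → ℕ
deg {n} G v = sum (map (λ u → if adj G v u then 1 else 0) (allFin n))

totDominated : ∀ {n} → Graph n → List (Fin n) → Fin n → Bool
totDominated G S x = any (adj G x) S

numDominated : ∀ {n} → Graph n → List (Fin n) → ℕ
numDominated {n} G S = sum (map (λ x → if totDominated G S x then 1 else 0) (allFin n))

isTotDom : ∀ {n} → Graph n → List (Fin n) → Bool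
isTotDom {n} G S = all (totDominated G S) (allFin n)

legalMoves : ∀ {n} → Graph n → List (Fin n) → List (Fin n)
legalMoves {n} G S = filterᵇ (λ v → numDominated G S <ᵇ numDominated G (v ∷ S)) (allFin n)

minL : List ℕ → ℕ
minL []       = 0
minL (x ∷ xs) = foldr _⊓_ x xs

maxL : List ℕ → ℕ
maxL = foldr _⊔_ 0

-- Optimal-play value of the game from position S (S = selected vertices so far):
-- number of further moves until the selected set is totally dominating.
-- Boolean argument: true = Dominator to move (minimises), false = Staller (maximises).
-- The first argument is fuel; each legal move totally dominates at least one new
-- vertex, so fuel n suffices from the start position.
gameValue : ∀ {n} → Graph n → ℕ → Bool → List (Fin n) → ℕ
gameValue G zero    d S = 0
gameValue G (suc k) d S =
  if isTotDom G S then 0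
  else suc ((if d then minL else maxL)
              (map (λ v → gameValue G k (not d) (v ∷ S)) (legalMoves G S)))

γtg : ∀ {n} → Graph n → ℕ
γtg {n} G = gameValue G n true []

{-# OPTIONS --safe #-}

-- For a position S let U be the set of undominated vertices, k(v) = |N(v) ∩ U|, and
-- Φ(S) = 2|U| + 3|{v : k(v) ≥ 1}|, so that Φ([]) ≤ 5n.  With Dominator to move, 7 times the
-- remaining length is at most Φ(S) + 2, and at most Φ(S) if all k(v) ≤ 2 and some k(v) = 1
-- (S is "thin" and "marked"; thinness persists).  A move at v costs at least 2k(v) + 3, and 3 more if it exhausts
-- another vertex, so two consecutive moves have to cost 14, up to the change of slack:
--   * if some k(v) ≥ 3, Dominator pays 9 there and Staller pays at least 5;
--   * if all k(v) ∈ {0, 2}, Dominator pays 7 anywhere; Staller then pays 7 or pays 5 and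
--     leaves a marked position, because every vertex has degree at least 2;
--   * in a thin marked position where some move costs 10, Dominator plays it; Staller pays 8,
--     or at least 5 leaving a marked position;
--   * in a thin marked position without such a move, Dominator plays a v with k(v) = 1, paying 8;
--     Staller pays 8, or 7 leaving a marked position, since a reply costing 5 would reveal
--     a move of cost 10 for Dominator.

module Submission where

open import Defs renaming (sym to adj-sym)
open import Data.Bool using (Bool; true; false; not; _∧_; _∨_; if_then_else_; T)
open import Data.Bool.Properties using (T-≡; ∨-zeroʳ)
open import Data.Bool.ListAction using (all)
open import Data.Empty using (⊥-elim)
open import Data.Fin using (Fin)
open import Data.Fin.Properties using (_≟_; any?)
open import Data.List using (List; []; _∷_; map; foldr; allFin; length)
open import Data.List.Properties using (length-tabulate)
open import Data.List.Membership.Propositional using (_∈_)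
open import Data.List.Membership.Propositional.Properties using (∈-allFin; ∈-map⁺; ∈-map⁻; ∈-filter⁺; ∈-filter⁻)
import Data.List.Relation.Unary.All as All
open import Data.List.Relation.Unary.AllPairs using (_∷_)
open import Data.List.Relation.Unary.Any using (here; there)
open import Data.List.Relation.Unary.Unique.Propositional using (Unique)
open import Data.List.Relation.Unary.Unique.Propositional.Properties using (allFin⁺)
open import Data.Nat using (ℕ; zero; suc; pred; _≤_; _<_; _*_; _+_; _⊓_; _<ᵇ_; z≤n; s≤s; _≤?_)
open import Data.Nat.ListAction using (sum)
open import Data.Nat.Properties as ℕ hiding (_≟_)
open import Data.Nat.Tactic.RingSolver using (solve-∀)
open import Data.Product using (∃; _×_; _,_; proj₁; proj₂)
open import Data.Sum using (_⊎_; inj₁; inj₂)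
open import Data.Unit using (tt)
open import Function using (_∘_)
open import Function.Bundles using (module Equivalence)
open import Relation.Binary.PropositionalEquality using (_≡_; _≢_; refl; sym; trans; cong; subst)
open import Relation.Nullary using (¬_; yes; no; contradiction)
open import Relation.Nullary.Decidable using (⌊_⌋; _×-dec_)

-- Boolean predicates and their counts

true≢false : ∀ {b} → b ≡ true → ¬ b ≡ false
true≢false refl ()

∧-intro : ∀ {a b} → a ≡ true → b ≡ true → a ∧ b ≡ true
∧-intro refl refl = refl

∧-elim : ∀ {a b} → a ∧ b ≡ true → a ≡ true × b ≡ true
∧-elim {true} {true} refl = refl , refl

T⇒≡ : ∀ {b} → T b → b ≡ true
T⇒≡ = Equivalence.to T-≡

≡⇒T : ∀ {b} → b ≡ true → T b
≡⇒T = Equivalence.from T-≡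

𝟙 : Bool → ℕ
𝟙 b = if b then 1 else 0

𝟙-mono : ∀ {a b} → (a ≡ true → b ≡ true) → 𝟙 a ≤ 𝟙 b
𝟙-mono {false} f = z≤n
𝟙-mono {true}  f rewrite f refl = ≤-refl

module _ {A : Set} where

  infix 4 _⊆ᵇ_
  _⊆ᵇ_ : (A → Bool) → (A → Bool) → Set
  p ⊆ᵇ q = ∀ x → p x ≡ true → q x ≡ true

  countIn : (A → Bool) → List A → ℕ
  countIn p xs = sum (map (λ x → 𝟙 (p x)) xs)

  countIn-mono : ∀ {p q} → p ⊆ᵇ q → ∀ xs → countIn p xs ≤ countIn q xs
  countIn-mono p⊆q []       = z≤n
  countIn-mono p⊆q (x ∷ xs) = +-mono-≤ (𝟙-mono (p⊆q x)) (countIn-mono p⊆q xs)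

  countIn-strict : ∀ {p q a} → p ⊆ᵇ q → q a ≡ true → p a ≡ false →
                   ∀ {xs} → a ∈ xs → countIn p xs < countIn q xs
  countIn-strict p⊆q qa pa {_ ∷ xs} (here refl) rewrite qa | pa = s≤s (countIn-mono p⊆q xs)
  countIn-strict {p} {q} p⊆q qa pa {x ∷ xs} (there a∈) =
    ≤-trans (≤-reflexive (sym (+-suc (𝟙 (p x)) _)))
            (+-mono-≤ (𝟙-mono (p⊆q x)) (countIn-strict p⊆q qa pa a∈))

  countIn-+ : ∀ {p q r} → (∀ x → 𝟙 (p x) + 𝟙 (q x) ≤ 𝟙 (r x)) →
              ∀ xs → countIn p xs + countIn q xs ≤ countIn r xs
  countIn-+ h [] = z≤n
  countIn-+ {p} {q} {r} h (x ∷ xs) =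
    ≤-trans (≤-reflexive (interchange (𝟙 (p x)) (countIn p xs) (𝟙 (q x)) (countIn q xs)))
            (+-mono-≤ (h x) (countIn-+ {p} {q} {r} h xs))
    where
    interchange : ∀ a b c d → (a + b) + (c + d) ≡ (a + c) + (b + d)
    interchange = solve-∀

  countIn≤length : ∀ p xs → countIn p xs ≤ length xs
  countIn≤length p []       = z≤n
  countIn≤length p (x ∷ xs) with p x
  ... | true  = s≤s (countIn≤length p xs)
  ... | false = m≤n⇒m≤1+n (countIn≤length p xs)

  countIn≥1 : ∀ p xs → 1 ≤ countIn p xs → ∃ λ a → a ∈ xs × p a ≡ true
  countIn≥1 p (x ∷ xs) h with p x in eq
  ... | true  = x , here refl , eq
  ... | false with countIn≥1 p xs h
  ...   | a , a∈ , pa = a , there a∈ , pa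

  countIn≥2 : ∀ p {xs} → Unique xs → 2 ≤ countIn p xs →
              ∃ λ a → ∃ λ b → a ≢ b × p a ≡ true × p b ≡ true
  countIn≥2 p {x ∷ xs} (x∉ ∷ u) h with p x in eq
  ... | false = countIn≥2 p u h
  ... | true with countIn≥1 p xs (≤-pred h)
  ...   | b , b∈ , pb = x , b , All.lookup x∉ b∈ , eq , pb

  all-false : ∀ (p : A → Bool) xs → all p xs ≡ false → ∃ λ a → p a ≡ false
  all-false p (x ∷ xs) h with p x in eq
  ... | false = x , eq
  ... | true  = all-false p xs h

-- Minima and maxima of lists of numbers

minL-≤ : ∀ {x xs} → x ∈ xs → minL xs ≤ x
minL-≤ {x} {y ∷ xs} (here refl) = base xs
  where
  base : ∀ xs → foldr _⊓_ x xs ≤ x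
  base []       = ≤-refl
  base (z ∷ zs) = ≤-trans (m⊓n≤n z _) (base zs)
minL-≤ {x} {y ∷ xs} (there x∈) = member x∈
  where
  member : ∀ {xs} → x ∈ xs → foldr _⊓_ y xs ≤ x
  member (here refl)         = m⊓n≤m x _
  member {z ∷ zs} (there x∈) = ≤-trans (m⊓n≤n z _) (member x∈)

-- `maxL` folds from the default 0, so `P 0` has to be supplied even for a nonempty list.
maxL-elim : (P : ℕ → Set) → P 0 → ∀ xs → (∀ {x} → x ∈ xs → P x) → P (maxL xs)
maxL-elim P p0 []       h = p0
maxL-elim P p0 (x ∷ xs) h with ⊔-sel x (maxL xs)
... | inj₁ e = subst P (sym e) (h (here refl))
... | inj₂ e = subst P (sym e) (maxL-elim P p0 xs (h ∘ there))

-- Counting on the vertex set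

module _ {n : ℕ} where

  count : (Fin n → Bool) → ℕ
  count p = countIn p (allFin n)

  count≤n : ∀ p → count p ≤ n
  count≤n p = ≤-trans (countIn≤length p (allFin n)) (≤-reflexive (length-tabulate _))

  count-mono : ∀ {p q} → p ⊆ᵇ q → count p ≤ count q
  count-mono p⊆q = countIn-mono p⊆q (allFin n)

  count-strict : ∀ {p q} a → p ⊆ᵇ q → q a ≡ true → p a ≡ false → count p < count q
  count-strict a p⊆q qa pa = countIn-strict p⊆q qa pa (∈-allFin a)

  -- Interpolating `p` with the single point `b` added splits the inclusion into two strict ones.
  count-strict₂ : ∀ {p q} a b → a ≢ b → p ⊆ᵇ q → q a ≡ true → p a ≡ false →
                  q b ≡ true → p b ≡ false → 2 + count p ≤ count q
  count-strict₂ {p} {q} a b a≢b p⊆q qa pa qb pb =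
    ≤-trans (s≤s (count-strict b p⊆p′ p′b pb)) (count-strict a p′⊆q qa p′a)
    where
    p′ : Fin n → Bool
    p′ x = ⌊ x ≟ b ⌋ ∨ p x
    p⊆p′ : p ⊆ᵇ p′
    p⊆p′ x px rewrite px = ∨-zeroʳ _
    p′⊆q : p′ ⊆ᵇ q
    p′⊆q x h with x ≟ b
    ... | yes refl = qb
    ... | no  _    = p⊆q x h
    p′b : p′ b ≡ true
    p′b with b ≟ b
    ... | yes _   = refl
    ... | no  b≢b = contradiction refl b≢b
    p′a : p′ a ≡ false
    p′a with a ≟ b
    ... | yes a≡b = contradiction a≡b a≢b
    ... | no  _   = pa

  count≥1-intro : ∀ {p} a → p a ≡ true → 1 ≤ count p
  count≥1-intro a pa = ≤-trans (s≤s z≤n) (count-strict {λ _ → false} a (λ _ ()) pa refl)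

  count≥2-intro : ∀ {p} a b → a ≢ b → p a ≡ true → p b ≡ true → 2 ≤ count p
  count≥2-intro a b a≢b pa pb =
    ≤-trans (s≤s (s≤s z≤n)) (count-strict₂ {λ _ → false} a b a≢b (λ _ ()) pa refl pb refl)

  count≤1-unique : ∀ {p} → count p ≤ 1 → ∀ a b → p a ≡ true → p b ≡ true → a ≡ b
  count≤1-unique h a b pa pb with a ≟ b
  ... | yes a≡b = a≡b
  ... | no  a≢b = contradiction (≤-trans (count≥2-intro a b a≢b pa pb) h) (<-irrefl refl)

  count≡0-intro : ∀ {p} → (∀ x → ¬ p x ≡ true) → count p ≡ 0
  count≡0-intro {p} h with count p in eq
  ... | zero  = refl
  ... | suc _ with countIn≥1 p (allFin n) (≤-trans (s≤s z≤n) (≤-reflexive (sym eq)))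
  ...   | a , _ , pa = contradiction pa (h a)

-- The potential

drop-arith : ∀ {u u′ k l l′} j → u′ + k ≤ u → j + l′ ≤ l →
             (2 * u′ + 3 * l′) + (2 * k + 3 * j) ≤ 2 * u + 3 * l
drop-arith {u} {u′} {k} {l} {l′} j hu hl =
  ≤-trans (≤-reflexive (regroup u′ k l′ j))
          (+-mono-≤ (*-monoʳ-≤ 2 hu) (*-monoʳ-≤ 3 hl))
  where
  regroup : ∀ u′ k l′ j → (2 * u′ + 3 * l′) + (2 * k + 3 * j) ≡ 2 * (u′ + k) + 3 * (j + l′)
  regroup = solve-∀

module _ {n : ℕ} (G : Graph n) where

  undominated : List (Fin n) → Fin n → Bool
  undominated S x = not (totDominated G S x)

  gains : List (Fin n) → Fin n → Fin n → Bool
  gains S v x = adj G v x ∧ undominated S x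

  gain : List (Fin n) → Fin n → ℕ
  gain S v = count (gains S v)

  live : List (Fin n) → Fin n → Bool
  live S v = 0 <ᵇ gain S v

  Φ : List (Fin n) → ℕ
  Φ S = 2 * count (undominated S) + 3 * count (live S)

  Thin : List (Fin n) → Set
  Thin S = ∀ v → gain S v ≤ 2

  Marked : List (Fin n) → Set
  Marked S = ∃ λ v → gain S v ≡ 1

  flip-adj : ∀ {u v b} → adj G u v ≡ b → adj G v u ≡ b
  flip-adj {u} {v} e = trans (adj-sym G v u) e

  undominated-∷⁺ : ∀ {S v x} → undominated S x ≡ true → adj G x v ≡ false →
                   undominated (v ∷ S) x ≡ true
  undominated-∷⁺ e a rewrite a = e

  undominated-∷⁻ : ∀ {S v x} → undominated (v ∷ S) x ≡ true →
                   undominated S x ≡ true × adj G x v ≡ false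
  undominated-∷⁻ {v = v} {x} e with adj G x v
  ... | false = e , refl

  dominated-∷ : ∀ {S v x} → adj G x v ≡ true → undominated (v ∷ S) x ≡ false
  dominated-∷ a rewrite a = refl

  gains-∷⁻ : ∀ S v w → gains (v ∷ S) w ⊆ᵇ gains S w
  gains-∷⁻ S v w x h with ∧-elim {adj G w x} h
  ... | a , u = ∧-intro a (proj₁ (undominated-∷⁻ {S} {v} {x} u))

  gain-∷ : ∀ S v w → gain (v ∷ S) w ≤ gain S w
  gain-∷ S v w = count-mono (gains-∷⁻ S v w)

  gain-∷-strict : ∀ {S v w x} → adj G v x ≡ true → gains S w x ≡ true →
                  gain (v ∷ S) w < gain S w
  gain-∷-strict {S} {v} {w} {x} a h = count-strict x (gains-∷⁻ S v w) h gone
    where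
    gone : gains (v ∷ S) w x ≡ false
    gone with adj G w x
    ... | false = refl
    ... | true  = dominated-∷ {S} {v} {x} (flip-adj a)

  thin-∷ : ∀ S v → Thin S → Thin (v ∷ S)
  thin-∷ S v t w = ≤-trans (gain-∷ S v w) (t w)

  gain≥1-elim : ∀ S v → 1 ≤ gain S v →
                ∃ λ x → adj G v x ≡ true × undominated S x ≡ true × gains S v x ≡ true
  gain≥1-elim S v h with countIn≥1 (gains S v) (allFin n) h
  ... | x , _ , g with ∧-elim {adj G v x} g
  ...   | a , u = x , a , u , g

  gain-self : ∀ S v → gain (v ∷ S) v ≡ 0
  gain-self S v = count≡0-intro λ x h → let (a , u) = ∧-elim {adj G v x} h in
    true≢false (flip-adj a) (proj₂ (undominated-∷⁻ {S} {v} {x} u))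

  live⁺ : ∀ S v → 1 ≤ gain S v → live S v ≡ true
  live⁺ S v h = T⇒≡ (<⇒<ᵇ h)

  live⁻ : ∀ S v → gain S v ≡ 0 → live S v ≡ false
  live⁻ S v e rewrite e = refl

  live-∷ : ∀ S v → live (v ∷ S) ⊆ᵇ live S
  live-∷ S v w h =
    live⁺ S w (≤-trans (<ᵇ⇒< 0 (gain (v ∷ S) w) (≡⇒T h)) (gain-∷ S v w))

  -- Vertices still undominated and vertices newly dominated by `v` form disjoint subsets of the old
  -- undominated set.
  undominated-drop : ∀ S v → count (undominated (v ∷ S)) + gain S v ≤ count (undominated S)
  undominated-drop S v = countIn-+ {p = undominated (v ∷ S)} {gains S v} {undominated S} pointwise (allFin n)
    where
    pointwise : ∀ x → 𝟙 (undominated (v ∷ S) x) + 𝟙 (gains S v x) ≤ 𝟙 (undominated S x)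
    pointwise x rewrite adj-sym G v x with adj G x v | totDominated G S x
    ... | true  | true  = z≤n
    ... | true  | false = ≤-refl
    ... | false | true  = z≤n
    ... | false | false = ≤-refl

  -- Once played, `v` has no undominated neighbour left and stops being live, which accounts for the
  -- 3.
  Φ-drop : ∀ S v k → 1 ≤ gain S v → k ≤ gain S v → Φ (v ∷ S) + (2 * k + 3) ≤ Φ S
  Φ-drop S v k g k≤ =
    drop-arith {u′ = count (undominated (v ∷ S))} 1 (≤-trans (+-monoʳ-≤ _ k≤) (undominated-drop S v))
      (count-strict v (live-∷ S v) (live⁺ S v g) (live⁻ (v ∷ S) v (gain-self S v)))

  Φ-drop₂ : ∀ S v v′ k → 1 ≤ gain S v → k ≤ gain S v →
            v ≢ v′ → 1 ≤ gain S v′ → gain (v ∷ S) v′ ≡ 0 → Φ (v ∷ S) + (2 * k + 6) ≤ Φ S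
  Φ-drop₂ S v v′ k g k≤ v≢v′ g′ dead =
    drop-arith {u′ = count (undominated (v ∷ S))} 2 (≤-trans (+-monoʳ-≤ _ k≤) (undominated-drop S v))
      (count-strict₂ v v′ v≢v′ (live-∷ S v) (live⁺ S v g) (live⁻ (v ∷ S) v (gain-self S v))
        (live⁺ S v′ g′) (live⁻ (v ∷ S) v′ dead))

-- The rules of the game

  -- Legality compares numbers of dominated vertices. The dominated set only grows, so one new
  -- member makes the number strictly larger.
  legal⁺ : ∀ S v → 1 ≤ gain S v → v ∈ legalMoves G S
  legal⁺ S v g with gain≥1-elim S v g
  ... | x , a , u , _ = ∈-filter⁺ _ (∈-allFin v) (<⇒<ᵇ (count-strict x grows new (old u)))
    where
    grows : totDominated G S ⊆ᵇ totDominated G (v ∷ S)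
    grows y d rewrite d = ∨-zeroʳ _
    new : totDominated G (v ∷ S) x ≡ true
    new rewrite flip-adj {v} {x} a = refl
    old : ∀ {b} → not b ≡ true → b ≡ false
    old {false} _ = refl

  legal⁻ : ∀ S v → v ∈ legalMoves G S → 1 ≤ gain S v
  legal⁻ S v v∈ with gain S v in eq
  ... | suc _ = s≤s z≤n
  ... | zero  = ⊥-elim (<-irrefl refl (<-≤-trans more (count-mono shrinks)))
    where
    more : numDominated G S < numDominated G (v ∷ S)
    more = <ᵇ⇒< _ _ (proj₂ (∈-filter⁻ _ {xs = allFin n} v∈))
    shrinks : totDominated G (v ∷ S) ⊆ᵇ totDominated G S
    shrinks x d with totDominated G S x in e | adj G x v in a
    ... | true  | _     = refl
    ... | false | true  = ⊥-elim (<-irrefl refl (≤-trans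
          (count≥1-intro {p = gains S v} x (∧-intro (flip-adj a) (cong not e))) (≤-reflexive eq)))

-- Optimal play

  module _ (δ : ∀ v → 2 ≤ deg G v) where

    -- Minimum degree 2 provides a second vertex competing for `x`.
    other-neighbour : ∀ x v → ∃ λ v′ → v ≢ v′ × adj G x v′ ≡ true
    other-neighbour x v with countIn≥2 (adj G x) (allFin⁺ n) (δ x)
    ... | a , b , a≢b , xa , xb with v ≟ a
    ...   | yes refl = b , a≢b , xb
    ...   | no  v≢a  = a , v≢a , xa

    unfinished : ∀ S → isTotDom G S ≡ false → ∃ λ v → 1 ≤ gain S v
    unfinished S e with all-false (totDominated G S) (allFin n) e
    ... | x , d with countIn≥2 (adj G x) (allFin⁺ n) (δ x)
    ...   | v , _ , _ , xv , _ =
      v , count≥1-intro {p = gains S v} x (∧-intro (flip-adj xv) (cong not d))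

    -- The leading 7 pays for the Dominator move just made, the 14 for that move and Staller's
    -- reply. If the game has already ended, only 7 is due.
    staller-turn : ∀ k S {b} → 7 ≤ b →
      (∀ w → 1 ≤ gain S w → 14 + 7 * gameValue G (pred k) true (w ∷ S) ≤ b) →
      7 + 7 * gameValue G k false S ≤ b
    staller-turn zero    S 7≤b h = 7≤b
    staller-turn (suc k) S {b} 7≤b h with isTotDom G S in e
    ... | true  = 7≤b
    ... | false = maxL-elim (λ t → 7 + 7 * suc t ≤ b) base _ member
      where
      -- The default 0 of `maxL` must also satisfy the bound; an unfinished game has a legal reply,
      -- which yields it.
      base : 14 ≤ b
      base = let (w , g) = unfinished S e in ≤-trans (m≤m+n 14 _) (h w g)
      member : ∀ {t} → t ∈ map (λ v → gameValue G k true (v ∷ S)) (legalMoves G S) →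
               7 + 7 * suc t ≤ b
      member t∈ with ∈-map⁻ _ t∈
      ... | w , w∈ , refl =
        ≤-trans (≤-reflexive (cong (7 +_) (*-suc 7 _))) (h w (legal⁻ S w w∈))

    dominator-turn : ∀ k S {b} v → 1 ≤ gain S v →
      7 + 7 * gameValue G k false (v ∷ S) ≤ b → 7 * gameValue G (suc k) true S ≤ b
    dominator-turn k S v g h with isTotDom G S
    ... | true  = z≤n
    ... | false = ≤-trans (*-monoʳ-≤ 7 (s≤s (minL-≤ (∈-map⁺ _ (legal⁺ S v g)))))
                          (≤-trans (≤-reflexive (*-suc 7 _)) h)

    -- The inductive claim and the accounting of one round

    Bound : ℕ → List (Fin n) → Set
    Bound k S = 7 * gameValue G k true S ≤ Φ S + 2
              × (Thin S → Marked S → 7 * gameValue G k true S ≤ Φ S + 0)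

    -- Here `d` and `e` are the potential paid by Dominator and by Staller's reply `w`, while `c`
    -- and `c′` are the slacks before and after the round.
    Affordable : ℕ → ℕ → ℕ → List (Fin n) → Fin n → Set
    Affordable k c d S w =
      ∃ λ e → ∃ λ c′ → Φ (w ∷ S) + e ≤ Φ S
        × 7 * gameValue G k true (w ∷ S) ≤ Φ (w ∷ S) + c′ × 14 + c′ ≤ (e + d) + c

    round : ∀ k S v {c} d → 1 ≤ gain S v → 7 ≤ d → Φ (v ∷ S) + d ≤ Φ S →
      (∀ w → 1 ≤ gain (v ∷ S) w → Affordable (pred k) c d (v ∷ S) w) →
      7 * gameValue G (suc k) true S ≤ Φ S + c
    round k S v {c} d g 7≤d drop replies = dominator-turn k S v g
      (staller-turn k (v ∷ S)
        (≤-trans 7≤d (≤-trans (m≤n+m d (Φ (v ∷ S))) (≤-trans drop (m≤m+n (Φ S) c)))) reply)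
      where
      regroup : ∀ a e d c → a + ((e + d) + c) ≡ ((a + e) + d) + c
      regroup = solve-∀
      swap : ∀ a c → 14 + (a + c) ≡ a + (14 + c)
      swap = solve-∀
      reply : ∀ w → 1 ≤ gain (v ∷ S) w →
              14 + 7 * gameValue G (pred k) true (w ∷ v ∷ S) ≤ Φ S + c
      reply w gw with replies w gw
      ... | e , c′ , drop′ , ih , enough = begin
        14 + 7 * gameValue G (pred k) true (w ∷ v ∷ S) ≤⟨ +-monoʳ-≤ 14 ih ⟩
        14 + (Φ (w ∷ v ∷ S) + c′)       ≡⟨ swap (Φ (w ∷ v ∷ S)) c′ ⟩
        Φ (w ∷ v ∷ S) + (14 + c′)       ≤⟨ +-monoʳ-≤ (Φ (w ∷ v ∷ S)) enough ⟩
        Φ (w ∷ v ∷ S) + ((e + d) + c)   ≡⟨ regroup (Φ (w ∷ v ∷ S)) e d c ⟩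
        ((Φ (w ∷ v ∷ S) + e) + d) + c   ≤⟨ +-monoˡ-≤ c (+-monoˡ-≤ d drop′) ⟩
        (Φ (v ∷ S) + d) + c             ≤⟨ +-monoˡ-≤ c drop ⟩
        Φ S + c                         ∎
        where open ≤-Reasoning

    -- The shared undominated neighbour `y` is kept because the tight case later counts it towards
    -- the gain of `w′`.
    record Marks (S : List (Fin n)) (w : Fin n) : Set where
      field
        {y w′}   : Fin n
        w≢w′     : w ≢ w′
        w-gains  : gains S w y ≡ true
        w′-gains : gains S w′ y ≡ true
        marked   : gain (w ∷ S) w′ ≡ 1

    -- An undominated neighbour `y` of `w` has another neighbour `w′`. Dominating `y` lowers the
    -- gain of `w′`, at most 2 by thinness, to 0 or 1: either `w′` is exhausted too, or it is a
    -- mark.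
    reply-dichotomy : ∀ S w → Thin S → 1 ≤ gain S w → Φ (w ∷ S) + 8 ≤ Φ S ⊎ Marks S w
    reply-dichotomy S w thin g with gain≥1-elim S w g
    ... | y , wy , uy , gy with other-neighbour y w
    ...   | w′ , w≢w′ , yw′ with gain (w ∷ S) w′ in eq
    ...     | 0 = inj₁ (Φ-drop₂ S w w′ 1 g g w≢w′
                    (count≥1-intro {p = gains S w′} y (∧-intro (flip-adj yw′) uy)) eq)
    ...     | 1 = inj₂ record { w≢w′ = w≢w′ ; w-gains = gy
                              ; w′-gains = ∧-intro (flip-adj yw′) uy ; marked = eq }
    ...     | suc (suc j) = ⊥-elim (<-irrefl refl
                (≤-trans (s≤s (≤-trans (s≤s (s≤s z≤n)) (≤-reflexive (sym eq))))
                  (≤-trans (gain-∷-strict {S} {w} {w′} {y} wy (∧-intro (flip-adj yw′) uy)) (thin w′))))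

    -- Dominator's strategy in each kind of position

    module _ (k : ℕ) (ih : ∀ S → Bound (pred k) S) (S : List (Fin n)) where

      Goal : ℕ → Set
      Goal c = 7 * gameValue G (suc k) true S ≤ Φ S + c

      thick-case : ∀ v → 3 ≤ gain S v → Goal 2
      thick-case v g = round k S v 9 g≥1 (≤ᵇ⇒≤ 7 9 tt) (Φ-drop S v 3 g≥1 g) λ w gw →
        5 , 2 , Φ-drop (v ∷ S) w 1 gw gw , proj₁ (ih _) , ≤ᵇ⇒≤ 16 16 tt
        where
        g≥1 : 1 ≤ gain S v
        g≥1 = ≤-trans (s≤s z≤n) g

      -- A marking reply pays 5 and leaves slack 0, so 14 requires `d + c` to be at least 9. A reply
      -- paying 8 leaves slack 2 and needs only 16 out of 17.
      generous-case : Thin S → ∀ c d v → 1 ≤ gain S v → Φ (v ∷ S) + d ≤ Φ S → 7 ≤ d → 9 ≤ d + c → Goal c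
      generous-case thin c d v g drop 7≤d 9≤d+c = round k S v d g 7≤d drop reply
        where
        enough : ∀ e → 9 + e ≤ (e + d) + c
        enough e = ≤-trans (≤-reflexive (+-comm 9 e))
                     (≤-trans (+-monoʳ-≤ e 9≤d+c) (≤-reflexive (sym (+-assoc e d c))))
        reply : ∀ w → 1 ≤ gain (v ∷ S) w → Affordable (pred k) c d (v ∷ S) w
        reply w gw with reply-dichotomy (v ∷ S) w (thin-∷ S v thin) gw
        ... | inj₁ d8 = 8 , 2 , d8 , proj₁ (ih _) , ≤-trans (≤ᵇ⇒≤ 16 17 tt) (enough 8)
        ... | inj₂ m  = 5 , 0 , Φ-drop (v ∷ S) w 1 gw gw
                      , proj₂ (ih _) (thin-∷ (v ∷ S) w (thin-∷ S v thin)) (_ , Marks.marked m)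
                      , enough 5

      tight-case : Thin S → (∀ v → ¬ (1 ≤ gain S v × Φ (v ∷ S) + 10 ≤ Φ S)) → Marked S → Goal 0
      tight-case thin cheap (v , gv≡1)
        with gain≥1-elim S v (≤-reflexive (sym gv≡1))
      ... | x , vx , ux , gx = round k S v 8 gv (≤ᵇ⇒≤ 7 8 tt) dominator-drop reply
        where
        gv : 1 ≤ gain S v
        gv = ≤-reflexive (sym gv≡1)

        only-x : ∀ y → gains S v y ≡ true → y ≡ x
        only-x y gy = count≤1-unique {p = gains S v} (≤-reflexive gv≡1) y x gy gx

        -- A further vertex `z` gained by `u` would make `u` a move of cost 10: it gains `x` and
        -- `z`, and dominating `x` exhausts `v`.
        exhausted : ∀ u → adj G x u ≡ true → gain (v ∷ S) u ≡ 0
        exhausted u xu = count≡0-intro contra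
          where
          contra : ∀ z → ¬ gains (v ∷ S) u z ≡ true
          contra z gz = cheap u (≤-trans (s≤s z≤n) gu , Φ-drop₂ S u v 2 (≤-trans (s≤s z≤n) gu) gu u≢v gv dead)
            where
            uz : adj G u z ≡ true
            uz = proj₁ (∧-elim gz)
            zv : adj G z v ≡ false
            zv = proj₂ (undominated-∷⁻ {S} {v} {z} (proj₂ (∧-elim {adj G u z} gz)))
            x≢z : x ≢ z
            x≢z refl = true≢false (flip-adj vx) zv
            gu : 2 ≤ gain S u
            gu = count≥2-intro {p = gains S u} x z x≢z (∧-intro (flip-adj xu) ux) (gains-∷⁻ S v u z gz)
            u≢v : u ≢ v
            u≢v refl = true≢false (flip-adj uz) zv
            dead : gain (u ∷ S) v ≡ 0
            dead = count≡0-intro λ t gt → true≢false xu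
              (subst (λ s → adj G s u ≡ false) (only-x t (gains-∷⁻ S u v t gt))
                (proj₂ (undominated-∷⁻ {S} {u} {t} (proj₂ (∧-elim {adj G v t} gt)))))

        dominator-drop : Φ (v ∷ S) + 8 ≤ Φ S
        dominator-drop with other-neighbour x v
        ... | v′ , v≢v′ , xv′ = Φ-drop₂ S v v′ 1 gv gv v≢v′
                (count≥1-intro {p = gains S v′} x (∧-intro (flip-adj xv′) ux)) (exhausted v′ xv′)

        -- Otherwise `w′` already costs 10 at `S`: it gains `y` and the leftover `z`, and it
        -- exhausts `w`.
        no-cheap-reply : ∀ w → gain (v ∷ S) w ≡ 1 → ¬ Marks (v ∷ S) w
        no-cheap-reply w gw≡1 m
          with gain≥1-elim (w ∷ v ∷ S) (Marks.w′ m) (≤-reflexive (sym (Marks.marked m)))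
        ... | z , w′z , uz , gz = cheap w′ (≤-trans (s≤s z≤n) gw′
                , Φ-drop₂ S w′ w 2 (≤-trans (s≤s z≤n) gw′) gw′ (w≢w′ ∘ sym) gw dead)
          where
          open Marks m
          gw : 1 ≤ gain S w
          gw = ≤-trans (≤-reflexive (sym gw≡1)) (gain-∷ S v w)
          y≢z : y ≢ z
          y≢z refl = true≢false (flip-adj (proj₁ (∧-elim w-gains))) (proj₂ (undominated-∷⁻ {v ∷ S} {w} {z} uz))
          gw′ : 2 ≤ gain S w′
          gw′ = count≥2-intro {p = gains S w′} y z y≢z (gains-∷⁻ S v w′ y w′-gains)
                  (gains-∷⁻ S v w′ z (gains-∷⁻ (v ∷ S) w w′ z gz))
          dead : gain (w′ ∷ S) w ≡ 0
          dead = count≡0-intro contra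
            where
            -- A vertex `t` still gained by `w` is impossible: if not adjacent to `v` it is `y`,
            -- which `w′` dominates; if adjacent to `v` it is `x`, and then `v` has exhausted `w`.
            contra : ∀ t → ¬ gains (w′ ∷ S) w t ≡ true
            contra t gt with ∧-elim {adj G w t} gt
            ... | wt , ut with undominated-∷⁻ {S} {w′} {t} ut | adj G t v in tv
            ...   | ut′ , tw′ | false = true≢false (flip-adj (proj₁ (∧-elim w′-gains)))
                    (subst (λ s → adj G s w′ ≡ false)
                      (count≤1-unique {p = gains (v ∷ S) w} (≤-reflexive gw≡1) t y
                        (∧-intro wt (undominated-∷⁺ {S} {v} {t} ut′ tv)) w-gains) tw′)
            ...   | ut′ , tw′ | true with only-x t (∧-intro (flip-adj tv) ut′)
            ...     | refl = contradiction (trans (sym gw≡1) (exhausted w (flip-adj wt))) λ ()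

        reply : ∀ w → 1 ≤ gain (v ∷ S) w → Affordable (pred k) 0 8 (v ∷ S) w
        reply w gw with reply-dichotomy (v ∷ S) w (thin-∷ S v thin) gw
        ... | inj₁ d8 = 8 , 2 , d8 , proj₁ (ih _) , ≤ᵇ⇒≤ 16 16 tt
        ... | inj₂ m with 2 ≤? gain (v ∷ S) w
        ...   | yes gw₂ = 7 , 0 , Φ-drop (v ∷ S) w 2 gw gw₂
                      , proj₂ (ih _) (thin-∷ (v ∷ S) w (thin-∷ S v thin)) (_ , Marks.marked m)
                      , ≤ᵇ⇒≤ 14 15 tt
        ...   | no  gw₁ = contradiction m (no-cheap-reply w (≤-antisym (≤-pred (≰⇒> gw₁)) gw))

      marked-case : Thin S → Marked S → Goal 0
      marked-case thin m with any? (λ v → (1 ≤? gain S v) ×-dec (Φ (v ∷ S) + 10 ≤? Φ S))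
      ... | yes (v , g , drop) = generous-case thin 0 10 v g drop (≤ᵇ⇒≤ 7 10 tt) (≤ᵇ⇒≤ 9 10 tt)
      ... | no  none           = tight-case thin (λ v h → none (v , h)) m

      pure-case : Thin S → ¬ Marked S → Goal 2
      pure-case thin pure = by-status (isTotDom G S) refl
        where
        by-status : ∀ b → isTotDom G S ≡ b → Goal 2
        by-status true  e rewrite e = z≤n
        by-status false e with unfinished S e
        ... | v , g = generous-case thin 2 7 v g (Φ-drop S v 2 g gain≥2) ≤-refl ≤-refl
          where
          gain≥2 : 2 ≤ gain S v
          -- Without marks no gain equals 1, so a positive gain is at least 2 and the move pays 7.
          gain≥2 = ≤∧≢⇒< g λ e₁ → pure (v , sym e₁)

      step : Bound (suc k) S
      step = slack-bound , marked-case
        where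
        thin : ¬ (∃ λ v → 3 ≤ gain S v) → Thin S
        thin thick v = ≤-pred (≰⇒> λ g → thick (v , g))
        slack-bound : Goal 2
        slack-bound with any? (λ v → 3 ≤? gain S v)
        ... | yes (v , g) = thick-case v g
        ... | no  thick   with any? (λ v → gain S v ℕ.≟ 1)
        ...   | yes m    = ≤-trans (marked-case (thin thick) m) (+-monoʳ-≤ (Φ S) z≤n)
        ...   | no  pure = pure-case (thin thick) pure

    -- A round consumes two units of fuel, hence the recursion in steps of two; with one unit, no
    -- fuel is left after Dominator's move.
    bound : ∀ k S → Bound k S
    bound zero          S = z≤n , λ _ _ → z≤n
    bound (suc zero)    S = step 0 (bound 0) S
    bound (suc (suc k)) S = step (suc k) (bound k) S

theorem1p3 : (n : ℕ) (G : Graph n) → (∀ (v : Fin n) → 2 ≤ deg G v) →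
    7 * γtg G ≤ 5 * n + 5
theorem1p3 n G δ = begin
  7 * γtg G               ≤⟨ proj₁ (bound G δ n []) ⟩
  -- Both counts in `Φ` are at most `n`, giving 5n; the slack 2 is relaxed to 5.
  Φ G [] + 2              ≤⟨ +-mono-≤ (+-mono-≤ (*-monoʳ-≤ 2 {y = n} (count≤n (undominated G [])))
                                            (*-monoʳ-≤ 3 (count≤n (live G [])))) (≤ᵇ⇒≤ 2 5 tt) ⟩
  (2 * n + 3 * n) + 5     ≡⟨ cong (_+ 5) (sym (*-distribʳ-+ n 2 3)) ⟩
  5 * n + 5               ∎
  where open ≤-Reasoning
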